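{- Let $n$ be a positive integer, let $\theta=\lambda/\mu$ be a skew Young diagram such that every column of $\theta$ contains at most $n$ boxes, and let $\beta$ be a nonzero complex number. Then $$G_\theta(\beta,\dots,\beta\mid -\beta^{ -1})=\beta^{|\theta|},$$ where all $n$ variables are specialized to $\beta$.
   Context: Partitions are identified with Young diagrams $\{(i,j)\in\mathbb{Z}_{>0}^2 : j\le\lambda_i\}$ (row index $i$ increasing downward). For partitions $\mu\subseteq\lambda$, $\theta=\lambda/\mu=\lambda\setminus\mu$ and $|\theta|$ is its number of boxes. A set-valued tableau of shape $\theta$ with entries in $[n]=\{1,\dots,n\}$ assigns a non-empty subset $T_{i,j}\subseteq[n]$ to each box $(i,j)\in\theta$ such that $\max T_{i,j}\le\min T_{i,j+1}$ whenever $(i,j),(i,j+1)\in\theta$ and $\max T_{i,j}<\min T_{i+1,j}$ whenever $(i,j),(i+1,j)\in\theta$; $\mathrm{SVT}(\theta,n)$ is the set of these. For such $T$, $|T|=\sum_{(i,j)\in\theta}|T_{i,j}|$, $\omega_k(T)$ is the number of boxes whose set contains $k$, and $x^{\omega(T)}=\prod_{k=1}^n x_k^{\omega_k(T)}$. The skew Grothendieck polynomial is $G_\theta(x_1,\dots,x_n\mid\beta)=\sum_{T\in\mathrm{SVT}(\theta,n)}\beta^{|T|-|\theta|}x^{\omega(T)}$. -}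

module Defs where

open import Algebra.Apartness.Bundles using (HeytingField; HeytingCommutativeRing)
open import Algebra.Bundles using (CommutativeRing)
import Algebra.Apartness.Properties.HeytingCommutativeRing as HCRProperties
open import Data.Fin.Base using (Fin; toℕ)
open import Data.Fin.Properties using (all?)
open import Data.Fin.Subset using (Subset; Side; inside; outside; Nonempty; ∣_∣)
  renaming (_∈_ to _∈ˢ_)
open import Data.Fin.Subset.Properties using (nonempty?) renaming (_∈?_ to _∈ˢ?_)
open import Data.List.Base as List
  using (List; []; _∷_; length; map; filter; concatMap; upTo; allFin; cartesianProductWith)
open import Data.List.Extrema.Nat using (max; min)
open import Data.List.Membership.Propositional using (_∈_)
open import Data.List.Membership.Propositional.Properties
  using (∈-cartesianProductWith⁺; ∈-filter⁺; ∈-filter⁻)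
open import Data.List.Relation.Unary.All using (All; []; _∷_)
open import Data.List.Relation.Unary.AllPairs using ([]; _∷_)
open import Data.List.Relation.Unary.Any using (here; there)
open import Data.List.Relation.Unary.Linked using (Linked)
open import Data.List.Relation.Unary.Unique.Propositional using (Unique)
open import Data.List.Relation.Unary.Unique.Propositional.Properties
  using (cartesianProductWith⁺; filter⁺)
open import Data.Nat.Base using (ℕ; zero; suc; _∸_; _≤_; _<_; _≥_; _>_)
open import Data.Nat.Properties using (_≟_; _≤?_; _<?_)
open import Data.Product.Base using (_×_; _,_; proj₁; proj₂)
open import Data.Product.Properties using (≡-dec)
open import Data.Vec.Base as Vec using (Vec; []; _∷_; lookup)
open import Data.Vec.Functional using (Vector)
open import Data.Vec.Properties using (∷-injective)
open import Function.Base using (_∘_)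
open import Function.Bundles using (_⇔_; mk⇔)
open import Relation.Binary.Definitions using (DecidableEquality)
open import Relation.Binary.PropositionalEquality.Core using (_≡_; refl)
open import Relation.Nullary.Decidable using (Dec; map′; ¬?; _×-dec_; _→-dec_)

record Partition : Set where
  field
    parts      : List ℕ
    decreasing : Linked _≥_ parts
    positive   : All (_> 0) parts

open Partition public

nth : List ℕ → ℕ → ℕ
nth []       _       = 0
nth (p ∷ ps) zero    = p
nth (p ∷ ps) (suc i) = nth ps i

-- (row , column), both counted from 0, so that the usual condition j ≤ λᵢ
-- for 1-based coordinates becomes j < λᵢ.
Box : Set
Box = ℕ × ℕ

_≟ᵇ_ : DecidableEquality Box
_≟ᵇ_ = ≡-dec _≟_ _≟_

right below : Box → Box
right (i , j) = i , suc j
below (i , j) = suc i , j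

infix 4 _∈ᴰ_ _∈ᴰ?_

_∈ᴰ_ : Box → Partition → Set
(i , j) ∈ᴰ p = j < nth (parts p) i

_∈ᴰ?_ : ∀ b p → Dec (b ∈ᴰ p)
(i , j) ∈ᴰ? p = j <? nth (parts p) i

diagram : Partition → List Box
diagram p = concatMap (λ i → map (i ,_) (upTo (nth (parts p) i))) (upTo (length (parts p)))

record SkewShape : Set where
  field
    outer inner : Partition
    inner⊆outer : ∀ b → b ∈ᴰ inner → b ∈ᴰ outer

open SkewShape public

boxes : SkewShape → List Box
boxes θ = filter (λ b → ¬? (b ∈ᴰ? inner θ)) (diagram (outer θ))

size : SkewShape → ℕ
size θ = length (boxes θ)

box : (θ : SkewShape) → Fin (size θ) → Box
box θ = List.lookup (boxes θ)

columnLength : SkewShape → ℕ → ℕ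
columnLength θ j = length (filter (λ b → proj₂ b ≟ j) (boxes θ))

-- The element k of Fin n stands for the entry k + 1 of [n] = {1,…,n}.
entries : ∀ {n} → Subset n → List ℕ
entries {n} S = map (suc ∘ toℕ) (filter (_∈ˢ? S) (allFin n))

-- The defaults 0 and n never matter on nonempty sets.
maxEntry minEntry : ∀ {n} → Subset n → ℕ
maxEntry     S = max 0 (entries S)
minEntry {n} S = min n (entries S)

-- The set at position k is the one assigned to the box  box θ k.
Filling : SkewShape → ℕ → Set
Filling θ n = Vec (Subset n) (size θ)

record IsSVT (θ : SkewShape) {n : ℕ} (T : Filling θ n) : Set where
  field
    nonempty : ∀ k → Nonempty (lookup T k)
    rows     : ∀ k l → box θ l ≡ right (box θ k) →
               maxEntry (lookup T k) ≤ minEntry (lookup T l)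
    columns  : ∀ k l → box θ l ≡ below (box θ k) →
               maxEntry (lookup T k) < minEntry (lookup T l)

isSVT? : ∀ θ {n} (T : Filling θ n) → Dec (IsSVT θ T)
isSVT? θ T = map′
  (λ (a , b , c) → record { nonempty = a ; rows = b ; columns = c })
  (λ t → IsSVT.nonempty t , IsSVT.rows t , IsSVT.columns t)
  (all? (λ k → nonempty? (lookup T k))
    ×-dec all? (λ k → all? λ l → (box θ l ≟ᵇ right (box θ k))
                 →-dec (maxEntry (lookup T k) ≤? minEntry (lookup T l)))
    ×-dec all? (λ k → all? λ l → (box θ l ≟ᵇ below (box θ k))
                 →-dec (maxEntry (lookup T k) <? minEntry (lookup T l))))

allVecs : ∀ {A : Set} → List A → ∀ m → List (Vec A m)
allVecs xs zero    = [] ∷ []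
allVecs xs (suc m) = cartesianProductWith _∷_ xs (allVecs xs m)

sides : List Side
sides = inside ∷ outside ∷ []

allFillings : ∀ θ n → List (Filling θ n)
allFillings θ n = allVecs (allVecs sides n) (size θ)

SVT : ∀ θ n → List (Filling θ n)
SVT θ n = filter (isSVT? θ) (allFillings θ n)

-- SVT θ n lists every set-valued tableau exactly once, so a sum over this
-- list is a sum over the set of tableaux.
private
  ∈-allVecs : ∀ {A : Set} {xs : List A} → (∀ x → x ∈ xs) →
              ∀ {m} (v : Vec A m) → v ∈ allVecs xs m
  ∈-allVecs all []      = here refl
  ∈-allVecs all (x ∷ v) = ∈-cartesianProductWith⁺ _∷_ (all x) (∈-allVecs all v)

  allVecs-unique : ∀ {A : Set} {xs : List A} → Unique xs → ∀ m → Unique (allVecs xs m)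
  allVecs-unique xs! zero    = [] ∷ []
  allVecs-unique xs! (suc m) =
    cartesianProductWith⁺ _∷_ ∷-injective xs! (allVecs-unique xs! m)

  ∈-sides : ∀ s → s ∈ sides
  ∈-sides inside  = here refl
  ∈-sides outside = there (here refl)

  sides-unique : Unique sides
  sides-unique = ((λ ()) ∷ []) ∷ [] ∷ []

∈-SVT : ∀ θ {n} {T : Filling θ n} → T ∈ SVT θ n ⇔ IsSVT θ T
∈-SVT θ {n} {T} = mk⇔
  (proj₂ ∘ ∈-filter⁻ (isSVT? θ) {xs = allFillings θ n})
  (∈-filter⁺ (isSVT? θ) (∈-allVecs (∈-allVecs ∈-sides) T))

SVT-unique : ∀ θ n → Unique (SVT θ n)
SVT-unique θ n =
  filter⁺ (isSVT? θ) (allVecs-unique (allVecs-unique sides-unique n) (size θ))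

-- |T|
weight : ∀ θ {n} → Filling θ n → ℕ
weight θ T = Vec.sum (Vec.map ∣_∣ T)

-- ωₖ(T)
ω : ∀ θ {n} → Filling θ n → Fin n → ℕ
ω θ T k = Vec.count (k ∈ˢ?_) T

module _ {c ℓ} (R : CommutativeRing c ℓ) where
  open CommutativeRing R
  open import Algebra.Properties.Semiring.Exp semiring using (_^_)
  open import Algebra.Properties.CommutativeMonoid.Sum *-commutativeMonoid
    using () renaming (sum to ∏)

  -- Every set in a tableau T is nonempty, so weight θ T ≥ size θ and the
  -- truncated subtraction is exact.
  Grothendieck : ∀ θ n → Vector Carrier n → Carrier → Carrier
  Grothendieck θ n x b = List.foldr _+_ 0# (map term (SVT θ n))
    where
    term : Filling θ n → Carrier
    term T = b ^ (weight θ T ∸ size θ) * ∏ (λ k → x k ^ ω θ T k)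

module Field {c ℓ₁ ℓ₂} (K : HeytingField c ℓ₁ ℓ₂) where
  open HeytingField K public
  open HeytingCommutativeRing heytingCommutativeRing public using (commutativeRing)
  open CommutativeRing commutativeRing public using (semiring)
  open import Algebra.Properties.Semiring.Exp semiring public using (_^_)

  inverse : ∀ x → x # 0# → Carrier
  inverse x x#0 = proj₁ (#⇒invertible x#0)

  -- #⇒invertible inverts x - 0# rather than x.
  *-inverseʳ : ∀ x (x#0 : x # 0#) → x * inverse x x#0 ≈ 1#
  *-inverseʳ x x#0 = trans
    (*-congʳ (sym (HCRProperties.x-0≈x heytingCommutativeRing x)))
    (proj₂ (proj₂ (#⇒invertible x#0)))

{-# OPTIONS --safe #-}
module Submission where

-- Since (-β⁻¹)^(|T|-|θ|) β^|T| is a product over boxes of (-β⁻¹)^(|S|-1) β^|S|, the boxes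
-- can be summed out one at a time in reading order.  The first remaining box b has no
-- left or upper neighbour left, so once all later boxes are filled its set S ranges over
-- the nonempty subsets of an interval of [n], and ∑ (-β⁻¹)^(|S|-1) β^|S| over these is β
-- as soon as the interval is nonempty.  To guarantee the latter, every tableau is required
-- to have entries > offset b in box b, the number of boxes above b in its column.  This
-- holds automatically, but is kept as an explicit condition because it is no longer implied
-- once the boxes above have been removed.  It puts the entry offset b + 1 in the interval:
-- offset b < n by the bound on the columns, offset b ≤ offset (right b) by the skew shape,
-- and offset b < offset (below b).

open import Defs
open import Algebra.Apartness.Bundles using (HeytingField)
open import Algebra.Bundles using (CommutativeRing)
open import Data.Bool.Base using (true; false; if_then_else_)
open import Data.Fin.Base as Fin using (Fin; zero; suc; toℕ)
import Data.Fin.Properties as Fin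
open import Data.Fin.Subset using (Subset; Nonempty; Lift; inside; outside; ⊥; ∣_∣)
  renaming (_∈_ to _∈ˢ_)
open import Data.Fin.Subset.Properties
  using (nonempty?; Lift?; Empty-unique; ∉⊥; ∣⊥∣≡0; x∈p⇒∣p-x∣<∣p∣; drop-∷-Empty)
  renaming (_∈?_ to _∈ˢ?_)
open import Data.List.Base as List
  using (List; []; _∷_; _++_; length; map; filter; upTo; downFrom; cartesianProductWith)
import Data.List.Extrema.Nat as Extrema
open import Data.List.Membership.Propositional using (_∈_; lose; find)
open import Data.List.Membership.Propositional.Properties
  using (∈-filter⁺; ∈-filter⁻; ∈-map⁺; ∈-map⁻; ∈-allFin; ∈-lookup; ∈-upTo⁺; ∈-upTo⁻;
         ∈-downFrom⁻; ∈-concatMap⁺; ∈-concatMap⁻)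
open import Data.List.Properties using (filter-accept; filter-none; filter-notAll; length-map)
open import Data.List.Relation.Binary.Sublist.Propositional using (⊆-refl)
import Data.List.Relation.Binary.Sublist.Propositional.Properties as Sublist
open import Data.List.Relation.Unary.All as All using (All; []; _∷_)
import Data.List.Relation.Unary.All.Properties as All
open import Data.List.Relation.Unary.AllPairs using (AllPairs; []; _∷_)
import Data.List.Relation.Unary.AllPairs.Properties as AllPairs
open import Data.List.Relation.Unary.Any as Any using (here; there)
open import Data.List.Relation.Unary.Any.Properties using (lookup-index)
open import Data.List.Relation.Unary.Linked using (Linked; []; [-]; _∷_)
open import Data.List.Relation.Unary.Unique.Propositional using (Unique)
open import Data.List.Relation.Unary.Unique.Propositional.Properties
  using (downFrom⁺; map⁺; filter⁺)
open import Data.Nat.Base as ℕ using (ℕ; zero; suc; NonZero; _∸_; _≤_; _<_; _≥_; z≤n; s≤s)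
import Data.Nat.Properties as ℕ
open import Data.Product.Base using (∃; _×_; _,_; proj₁; proj₂)
open import Data.Product.Properties using (,-injectiveˡ)
open import Data.Sum.Base using (_⊎_; inj₁; inj₂)
open import Data.Unit.Base using (⊤; tt)
open import Data.Vec.Base as Vec using (Vec; []; _∷_; lookup; here; there)
open import Function.Base using (_∘_; id)
open import Relation.Binary.Definitions using (DecidableEquality)
open import Relation.Binary.PropositionalEquality as ≡ using (_≡_; _≢_)
open import Relation.Nullary.Decidable using (Dec; yes; no; does; ¬?; _×-dec_; _→-dec_)
open import Relation.Nullary.Negation using (¬_; contradiction)
open import Relation.Unary using (Decidable)

-- Young diagrams

nth-antitone : ∀ {ps} → Linked _≥_ ps → ∀ {i i′} → i ≤ i′ → nth ps i′ ≤ nth ps i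
nth-antitone _        {i′ = zero}  z≤n       = ℕ.≤-refl
nth-antitone []       {i′ = suc _} _         = z≤n
nth-antitone [-]      {i′ = suc _} _         = z≤n
nth-antitone (p ∷ ps) {i′ = suc i′} z≤n      = ℕ.≤-trans (nth-antitone ps {zero} {i′} z≤n) p
nth-antitone (p ∷ ps) {i′ = suc _} (s≤s i≤i′) = nth-antitone ps i≤i′

∈ᴰ-above : ∀ p {i i′ j} → i ≤ i′ → (i′ , j) ∈ᴰ p → (i , j) ∈ᴰ p
∈ᴰ-above p i≤i′ j< = ℕ.≤-trans j< (nth-antitone (decreasing p) i≤i′)

nth-positive⇒<length : ∀ ps {i j} → j < nth ps i → i < length ps
nth-positive⇒<length []       ()
nth-positive⇒<length (p ∷ ps) {zero}  _ = s≤s z≤n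
nth-positive⇒<length (p ∷ ps) {suc i} q = s≤s (nth-positive⇒<length ps q)

∈-diagram⁺ : ∀ p {b} → b ∈ᴰ p → b ∈ diagram p
∈-diagram⁺ p {i , j} b∈p = ∈-concatMap⁺ _
  (lose (∈-upTo⁺ (nth-positive⇒<length (parts p) b∈p)) (∈-map⁺ (i ,_) (∈-upTo⁺ b∈p)))

∈-diagram⁻ : ∀ p {b} → b ∈ diagram p → b ∈ᴰ p
∈-diagram⁻ p b∈ with find (∈-concatMap⁻ _ {xs = upTo (length (parts p))} b∈)
... | i , _ , b∈row with ∈-map⁻ (i ,_) b∈row
...   | j , j∈ , ≡.refl = ∈-upTo⁻ j∈

∉inner? : ∀ θ b → Dec (¬ (b ∈ᴰ inner θ))
∉inner? θ b = ¬? (b ∈ᴰ? inner θ)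

infix 4 _∈ᶿ_

_∈ᶿ_ : Box → SkewShape → Set
b ∈ᶿ θ = b ∈ᴰ outer θ × ¬ (b ∈ᴰ inner θ)

∈-boxes⁺ : ∀ θ {b} → b ∈ᶿ θ → b ∈ boxes θ
∈-boxes⁺ θ (b∈λ , b∉μ) = ∈-filter⁺ (∉inner? θ) (∈-diagram⁺ (outer θ) b∈λ) b∉μ

∈-boxes⁻ : ∀ θ {b} → b ∈ boxes θ → b ∈ᶿ θ
∈-boxes⁻ θ b∈
  with b∈λ , b∉μ ← ∈-filter⁻ (∉inner? θ) {xs = diagram (outer θ)} b∈
  = ∈-diagram⁻ (outer θ) b∈λ , b∉μ

infix 4 _≺_

_≺_ : Box → Box → Set
(i , j) ≺ (i′ , j′) = i < i′ ⊎ (i ≡ i′ × j < j′)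

-- `diagram` lists row after row, each from left to right, and filtering keeps this order. Hence
-- right and lower neighbours always come later in the list, where `Allowed` looks for them.
boxes-sorted : ∀ θ → AllPairs _≺_ (boxes θ)
boxes-sorted θ = AllPairs.filter⁺ (∉inner? θ) (AllPairs.concat⁺
  (All.map⁺ {f = row} (All.universal (λ i → AllPairs.map⁺ {f = i ,_}
    (AllPairs.applyUpTo⁺₁ id _ λ j<j′ _ → inj₂ (≡.refl , j<j′)))
    (upTo (length (parts (outer θ))))))
  (AllPairs.map⁺ {f = row} (AllPairs.applyUpTo⁺₁ id _ λ {i} {i′} i<i′ _ →
    All.map⁺ {f = i ,_} (All.universal (λ j →
      All.map⁺ {f = i′ ,_} (All.universal (λ j′ → inj₁ i<i′) _)) _))))
  where
  row = λ i → map (i ,_) (upTo (nth (parts (outer θ)) i))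

≺⇒≢right : ∀ {b c} → b ≺ c → b ≢ right c
≺⇒≢right (inj₁ i<i) ≡.refl      = ℕ.<-irrefl ≡.refl i<i
≺⇒≢right (inj₂ (_ , j<)) ≡.refl = ℕ.<-asym j< ℕ.≤-refl

≺⇒≢below : ∀ {b c} → b ≺ c → b ≢ below c
≺⇒≢below (inj₁ i<) ≡.refl       = ℕ.<-asym i< ℕ.≤-refl
≺⇒≢below (inj₂ (eq , _)) ≡.refl = ℕ.1+n≢n eq

-- Offsets in columns

-- By induction on `xs`: deleting its head from `ys` shortens `ys` and, by uniqueness, loses no
-- element of the tail.
unique⊆⇒length≤ : ∀ {A : Set} → DecidableEquality A → ∀ {xs ys : List A} →
                  Unique xs → (∀ {x} → x ∈ xs → x ∈ ys) → length xs ≤ length ys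
unique⊆⇒length≤ _≟ᴬ_ []           sub = z≤n
unique⊆⇒length≤ _≟ᴬ_ {x ∷ _} {ys} (x∉xs ∷ xs!) sub = ℕ.≤-trans
  (s≤s (unique⊆⇒length≤ _≟ᴬ_ xs! λ z∈xs →
    ∈-filter⁺ ≢x? (sub (there z∈xs)) (All.lookup x∉xs z∈xs)))
  (filter-notAll ≢x? ys (lose (sub (here ≡.refl)) λ x≢x → x≢x ≡.refl))
  where
  ≢x? = λ y → ¬? (x ≟ᴬ y)

-- For `(i , j)` in the outer diagram these are the rows of the boxes of `θ` above it. `downFrom`
-- lists the nearest row first, so moving one box down only adds a candidate at the head.
rowsAbove : SkewShape → Box → List ℕ
rowsAbove θ (i , j) = filter (λ i′ → ∉inner? θ (i′ , j)) (downFrom i)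

offset : SkewShape → Box → ℕ
offset θ b = length (rowsAbove θ b)

offset-below : ∀ θ {b} → b ∈ᶿ θ → offset θ (below b) ≡ suc (offset θ b)
offset-below θ {i , j} (_ , b∉μ) =
  ≡.cong length (filter-accept (λ i′ → ∉inner? θ (i′ , j)) b∉μ)

-- Rows of the inner diagram are initial segments, so a row that leaves it by column `j` has also
-- left it at column `suc j`.
offset-right : ∀ θ b → offset θ b ≤ offset θ (right b)
offset-right θ (i , j) = Sublist.length-mono-≤ (Sublist.filter⁺
  (λ i′ → ∉inner? θ (i′ , j)) (λ i′ → ∉inner? θ (i′ , suc j))
  (λ { ≡.refl j∉μ 1+j∈μ → j∉μ (ℕ.<⇒≤ 1+j∈μ) }) (⊆-refl {x = downFrom i}))

offset-zero : ∀ θ {i j} → (i , j) ∈ᴰ inner θ → offset θ (suc i , j) ≡ 0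
offset-zero θ {i} {j} b∈μ = ≡.cong length (filter-none (λ i′ → ∉inner? θ (i′ , j))
  (All.tabulate λ i′∈ b∉μ → b∉μ (∈ᴰ-above (inner θ) (ℕ.≤-pred (∈-downFrom⁻ {suc i} i′∈)) b∈μ)))

-- The box and those above it are distinct boxes of one column; their rows are `rowsAbove` of the
-- position just below.
offset<columnLength : ∀ θ {b} → b ∈ᶿ θ → offset θ b < columnLength θ (proj₂ b)
offset<columnLength θ {i , j} b∈θ@(b∈λ , _) = ≡.subst (_≤ columnLength θ j)
  (≡.trans (length-map (_, j) rows) (offset-below θ b∈θ))
  (unique⊆⇒length≤ _≟ᵇ_
    (map⁺ ,-injectiveˡ (filter⁺ (λ i′ → ∉inner? θ (i′ , j)) (downFrom⁺ (suc i)))) inColumn)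
  where
  rows = rowsAbove θ (suc i , j)
  inColumn : ∀ {c} → c ∈ map (_, j) rows → c ∈ filter (λ c → proj₂ c ℕ.≟ j) (boxes θ)
  inColumn c∈ with ∈-map⁻ (_, j) c∈
  ... | i′ , i′∈ , ≡.refl with ∈-filter⁻ (λ i′ → ∉inner? θ (i′ , j)) {xs = downFrom (suc i)} i′∈
  ...   | i′∈′ , c∉μ = ∈-filter⁺ (λ c → proj₂ c ℕ.≟ j)
    (∈-boxes⁺ θ (∈ᴰ-above (outer θ) (ℕ.≤-pred (∈-downFrom⁻ {suc i} i′∈′)) b∈λ , c∉μ)) ≡.refl

-- Set-valued tableaux

∈-entries⁺ : ∀ {n} {S : Subset n} {x} → x ∈ˢ S → suc (toℕ x) ∈ entries S
∈-entries⁺ {S = S} x∈S = ∈-map⁺ (suc ∘ toℕ) (∈-filter⁺ (_∈ˢ? S) (∈-allFin _) x∈S)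

allEntries : ∀ {n} {P : ℕ → Set} (S : Subset n) →
             (∀ x → x ∈ˢ S → P (suc (toℕ x))) → All P (entries S)
allEntries {n} S h = All.map⁺ (All.tabulate λ x∈ →
  h _ (proj₂ (∈-filter⁻ (_∈ˢ? S) {xs = List.allFin n} x∈)))

x≤maxEntry : ∀ {n} {S : Subset n} {x} → x ∈ˢ S → suc (toℕ x) ≤ maxEntry S
x≤maxEntry {S = S} x∈S = All.lookup (Extrema.xs≤max 0 (entries S)) (∈-entries⁺ x∈S)

minEntry≤x : ∀ {n} {S : Subset n} {x} → x ∈ˢ S → minEntry S ≤ suc (toℕ x)
minEntry≤x {n} {S} x∈S = All.lookup (Extrema.min≤xs n (entries S)) (∈-entries⁺ x∈S)

module _ {n} {S S′ : Subset n} where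

  max≤min⁺ : (∀ x y → x ∈ˢ S → y ∈ˢ S′ → x Fin.≤ y) → maxEntry S ≤ minEntry S′
  max≤min⁺ h = Extrema.max≤v⁺ z≤n (allEntries S λ x x∈S →
    Extrema.v≤min⁺ (Fin.toℕ<n x) (allEntries S′ λ y y∈S′ → s≤s (h x y x∈S y∈S′)))

  max≤min⁻ : maxEntry S ≤ minEntry S′ → ∀ x y → x ∈ˢ S → y ∈ˢ S′ → x Fin.≤ y
  max≤min⁻ h x y x∈S y∈S′ =
    ℕ.≤-pred (ℕ.≤-trans (x≤maxEntry x∈S) (ℕ.≤-trans h (minEntry≤x y∈S′)))

  -- For empty `S′` the default `n` of `minEntry` would not exceed an entry `n` of `S`. An element
  -- `z` of `S′` keeps all entries of `S` below `n`, and makes `n` positive in case `S` is empty.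
  max<min⁺ : Nonempty S′ → (∀ x y → x ∈ˢ S → y ∈ˢ S′ → x Fin.< y) → maxEntry S < minEntry S′
  max<min⁺ (z , z∈S′) h = Extrema.max<v⁺
    (Extrema.v<min⁺ (ℕ.≤-<-trans z≤n (Fin.toℕ<n z)) (allEntries S′ λ _ _ → s≤s z≤n))
    (allEntries S λ x x∈S →
      Extrema.v<min⁺ (ℕ.≤-<-trans (h x z x∈S z∈S′) (Fin.toℕ<n z))
        (allEntries S′ λ y y∈S′ → s≤s (h x y x∈S y∈S′)))

  max<min⁻ : maxEntry S < minEntry S′ → ∀ x y → x ∈ˢ S → y ∈ˢ S′ → x Fin.< y
  max<min⁻ h x y x∈S y∈S′ =
    ℕ.≤-pred (ℕ.≤-trans (s≤s (x≤maxEntry x∈S)) (ℕ.≤-trans h (minEntry≤x y∈S′)))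

-- Admissible fillings and their equivalence with tableaux

module Admissibility (θ : SkewShape) {n : ℕ} where

  -- A condition on single entries: with `T` fixed, the sets that may fill `b` are exactly the
  -- nonempty subsets of one set of entries. Conditions from the left and from above are recorded at
  -- those neighbours instead.
  Allowed : Box → ∀ (bs : List Box) → Vec (Subset n) (length bs) → Fin n → Set
  Allowed b bs T x = offset θ b ≤ toℕ x
    × (∀ l → List.lookup bs l ≡ right b → ∀ y → y ∈ˢ lookup T l → x Fin.≤ y)
    × (∀ l → List.lookup bs l ≡ below b → ∀ y → y ∈ˢ lookup T l → x Fin.< y)

  Admissible : ∀ (bs : List Box) → Vec (Subset n) (length bs) → Set
  Admissible []       []      = ⊤
  Admissible (b ∷ bs) (S ∷ T) =
    (Nonempty S × Lift (Allowed b bs T) S) × Admissible bs T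

  allowed? : ∀ b bs T x → Dec (Allowed b bs T x)
  allowed? b bs T x = (offset θ b ℕ.≤? toℕ x)
    ×-dec Fin.all? (λ l → (List.lookup bs l ≟ᵇ right b)
            →-dec Fin.all? (λ y → (y ∈ˢ? lookup T l) →-dec (x Fin.≤? y)))
    ×-dec Fin.all? (λ l → (List.lookup bs l ≟ᵇ below b)
            →-dec Fin.all? (λ y → (y ∈ˢ? lookup T l) →-dec (x Fin.<? y)))

  admissible? : ∀ bs T → Dec (Admissible bs T)
  admissible? []       []      = yes tt
  admissible? (b ∷ bs) (S ∷ T) =
    (nonempty? S ×-dec Lift? (allowed? b bs T) S) ×-dec admissible? bs T

  admissible⇒nonempty : ∀ bs T → Admissible bs T → ∀ k → Nonempty (lookup T k)
  admissible⇒nonempty (_ ∷ _)  (_ ∷ _) ((ne , _) , _) zero    = ne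
  admissible⇒nonempty (_ ∷ bs) (_ ∷ T) (_ , adm)      (suc k) = admissible⇒nonempty bs T adm k

  admissible⇒offset≤ : ∀ bs T → Admissible bs T → ∀ k x → x ∈ˢ lookup T k →
                       offset θ (List.lookup bs k) ≤ toℕ x
  admissible⇒offset≤ (_ ∷ _)  (_ ∷ _) ((_ , h) , _) zero    x x∈ = proj₁ (h x∈)
  admissible⇒offset≤ (_ ∷ bs) (_ ∷ T) (_ , adm)     (suc k) x x∈ =
    admissible⇒offset≤ bs T adm k x x∈

  admissible⇒rows : ∀ {bs} → AllPairs _≺_ bs → ∀ T → Admissible bs T →
    ∀ k l → List.lookup bs l ≡ right (List.lookup bs k) →
    ∀ x y → x ∈ˢ lookup T k → y ∈ˢ lookup T l → x Fin.≤ y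
  -- A right neighbour cannot precede its box in reading order. The case of two `zero`s is absent
  -- because no box is its own right neighbour.
  admissible⇒rows (b≺ ∷ _)  (_ ∷ _) _             (suc k) zero    eq =
    contradiction eq (≺⇒≢right (All.lookup b≺ (∈-lookup k)))
  admissible⇒rows (_ ∷ _)   (_ ∷ _) ((_ , h) , _) zero    (suc l) eq x y x∈ =
    proj₁ (proj₂ (h x∈)) l eq y
  admissible⇒rows (_ ∷ bs≺) (_ ∷ T) (_ , adm)     (suc k) (suc l) eq =
    admissible⇒rows bs≺ T adm k l eq

  admissible⇒columns : ∀ {bs} → AllPairs _≺_ bs → ∀ T → Admissible bs T →
    ∀ k l → List.lookup bs l ≡ below (List.lookup bs k) →
    ∀ x y → x ∈ˢ lookup T k → y ∈ˢ lookup T l → x Fin.< y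
  admissible⇒columns (b≺ ∷ _)  (_ ∷ _) _             (suc k) zero    eq =
    contradiction eq (≺⇒≢below (All.lookup b≺ (∈-lookup k)))
  admissible⇒columns (_ ∷ _)   (_ ∷ _) ((_ , h) , _) zero    (suc l) eq x y x∈ =
    proj₂ (proj₂ (h x∈)) l eq y
  admissible⇒columns (_ ∷ bs≺) (_ ∷ T) (_ , adm)     (suc k) (suc l) eq =
    admissible⇒columns bs≺ T adm k l eq

  mkAdmissible : ∀ bs T →
    (∀ k → Nonempty (lookup T k)) →
    (∀ k x → x ∈ˢ lookup T k → offset θ (List.lookup bs k) ≤ toℕ x) →
    (∀ k l → List.lookup bs l ≡ right (List.lookup bs k) →
      ∀ x y → x ∈ˢ lookup T k → y ∈ˢ lookup T l → x Fin.≤ y) →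
    (∀ k l → List.lookup bs l ≡ below (List.lookup bs k) →
      ∀ x y → x ∈ˢ lookup T k → y ∈ˢ lookup T l → x Fin.< y) →
    Admissible bs T
  mkAdmissible []       []      _  _   _ _ = tt
  mkAdmissible (b ∷ bs) (S ∷ T) ne off r c =
    (ne zero , λ {x} x∈ → off zero x x∈
      , (λ l eq y → r zero (suc l) eq x y x∈)
      , (λ l eq y → c zero (suc l) eq x y x∈))
    , mkAdmissible bs T (ne ∘ suc) (off ∘ suc)
        (λ k l → r (suc k) (suc l)) (λ k l → c (suc k) (suc l))

  module _ {T : Filling θ n} (t : IsSVT θ T) where
    open IsSVT t

    -- Induction on the row. If the box above lies in the inner diagram, the offset is 0. Otherwise
    -- it is a box of `θ`, and any entry `y` of its set is at least its offset and strictly below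
    -- `x`.
    svt⇒offset≤ : ∀ i j k → box θ k ≡ (i , j) → ∀ x → x ∈ˢ lookup T k → offset θ (i , j) ≤ toℕ x
    svt⇒offset≤ zero    j k eq x x∈ = z≤n
    svt⇒offset≤ (suc i) j k eq x x∈ with (i , j) ∈ᴰ? inner θ
    ... | yes c∈μ rewrite offset-zero θ c∈μ = z≤n
    ... | no  c∉μ = ≡.subst (_≤ toℕ x) (≡.sym (offset-below θ c∈θ))
      (ℕ.≤-<-trans (svt⇒offset≤ i j k′ (≡.sym c≡) y y∈)
        (max<min⁻ (columns k′ k (≡.trans eq (≡.cong below c≡))) y x y∈ x∈))
      where
      c∈θ : (i , j) ∈ᶿ θ
      c∈θ = ∈ᴰ-above (outer θ) (ℕ.n≤1+n i)
              (proj₁ (∈-boxes⁻ θ (≡.subst (_∈ boxes θ) eq (∈-lookup k)))) , c∉μ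
      c∈boxes = ∈-boxes⁺ θ c∈θ
      k′ = Any.index c∈boxes
      c≡ : (i , j) ≡ box θ k′
      c≡ = lookup-index c∈boxes
      y  = proj₁ (nonempty k′)
      y∈ = proj₂ (nonempty k′)

  svt⇒admissible : ∀ {T} → IsSVT θ T → Admissible (boxes θ) T
  svt⇒admissible {T} t = mkAdmissible (boxes θ) T nonempty
    (λ k → svt⇒offset≤ t _ _ k ≡.refl)
    (λ k l eq → max≤min⁻ (rows k l eq))
    (λ k l eq → max<min⁻ (columns k l eq))
    where open IsSVT t

  admissible⇒svt : ∀ {T} → Admissible (boxes θ) T → IsSVT θ T
  admissible⇒svt {T} adm = record
    { nonempty = ne
    ; rows     = λ k l eq → max≤min⁺ (admissible⇒rows (boxes-sorted θ) T adm k l eq)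
    ; columns  = λ k l eq → max<min⁺ (ne l) (admissible⇒columns (boxes-sorted θ) T adm k l eq)
    }
    where
    ne = admissible⇒nonempty (boxes θ) T adm

  allowed-offset : (∀ j → columnLength θ j ≤ n) → ∀ b bs T →
    b ∈ᶿ θ → Admissible bs T → ∃ (Allowed b bs T)
  allowed-offset col b bs T b∈θ adm =
    Fin.fromℕ< off<n
    , ≡.subst (offset θ b ≤_) (≡.sym eq) ℕ.≤-refl
    , (λ l l-eq y y∈ → ≡.subst (_≤ toℕ y) (≡.sym eq) (ℕ.≤-trans (offset-right θ b)
        (bound l l-eq y y∈)))
    , (λ l l-eq y y∈ → ≡.subst (_< toℕ y) (≡.sym eq) (≡.subst (_≤ toℕ y) (offset-below θ b∈θ)
        (bound l l-eq y y∈)))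
    where
    off<n = ℕ.<-≤-trans (offset<columnLength θ b∈θ) (col (proj₂ b))
    eq = Fin.toℕ-fromℕ< off<n
    -- Entries of a later box `c` respect the offset of `c` because `T` is admissible, even though
    -- the boxes above `c` may no longer be in `bs`.
    bound : ∀ l {c} → List.lookup bs l ≡ c → ∀ y → y ∈ˢ lookup T l → offset θ c ≤ toℕ y
    bound l ≡.refl y y∈ = admissible⇒offset≤ bs T adm l y y∈

-- Cardinalities of fillings

totalSize : ∀ {n m} → Vec (Subset n) m → ℕ
totalSize T = Vec.sum (Vec.map ∣_∣ T)

nonempty⇒∣p∣>0 : ∀ {n} {S : Subset n} → Nonempty S → 0 < ∣ S ∣
nonempty⇒∣p∣>0 (x , x∈S) = ℕ.≤-<-trans z≤n (x∈p⇒∣p-x∣<∣p∣ x∈S)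

nonempty⇒length≤totalSize : ∀ {n m} (T : Vec (Subset n) m) →
  (∀ k → Nonempty (lookup T k)) → m ≤ totalSize T
nonempty⇒length≤totalSize []      ne = z≤n
nonempty⇒length≤totalSize (S ∷ T) ne =
  ℕ.+-mono-≤ (nonempty⇒∣p∣>0 (ne zero)) (nonempty⇒length≤totalSize T (ne ∘ suc))

-- Sums over lists in a commutative ring

module RingSums {c ℓ} (R : CommutativeRing c ℓ) where
  open CommutativeRing R hiding (zero)
  open import Algebra.Properties.Semiring.Exp semiring using (_^_; ^-homo-*)
  open import Algebra.Properties.CommutativeSemiring.Exp commutativeSemiring using (^-distrib-*)
  open import Algebra.Properties.CommutativeMonoid.Sum *-commutativeMonoid
    using (sum-cong-≋; ∑-distrib-+; sum-replicate-zero) renaming (sum to ∏)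
  open import Algebra.Properties.Ring ring using (-1*x≈-x; -‿involutive)
  open import Algebra.Solver.Ring.NaturalCoefficients.Default commutativeSemiring
    using (solve; _:=_; _:*_; _:+_; con)
  open import Relation.Binary.Reasoning.Setoid setoid

  ∑ : {A : Set} → List A → (A → Carrier) → Carrier
  ∑ xs f = List.foldr _+_ 0# (map f xs)

  module _ {A : Set} where

    ∑-cong : ∀ (xs : List A) {f g} → (∀ x → f x ≈ g x) → ∑ xs f ≈ ∑ xs g
    ∑-cong []       f≈g = refl
    ∑-cong (x ∷ xs) f≈g = +-cong (f≈g x) (∑-cong xs f≈g)

    ∑-zero : ∀ (xs : List A) → ∑ xs (λ _ → 0#) ≈ 0#
    ∑-zero []       = refl
    ∑-zero (x ∷ xs) = trans (+-identityˡ _) (∑-zero xs)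

    ∑-+ : ∀ (xs : List A) f g → ∑ xs (λ x → f x + g x) ≈ ∑ xs f + ∑ xs g
    ∑-+ []       f g = sym (+-identityˡ 0#)
    ∑-+ (x ∷ xs) f g = trans (+-congˡ (∑-+ xs f g))
      (solve 4 (λ a b c d → (a :+ b) :+ (c :+ d) := (a :+ c) :+ (b :+ d)) refl _ _ _ _)

    ∑-*ˡ : ∀ (xs : List A) a f → ∑ xs (λ x → a * f x) ≈ a * ∑ xs f
    ∑-*ˡ []       a f = sym (zeroʳ a)
    ∑-*ˡ (x ∷ xs) a f = trans (+-congˡ (∑-*ˡ xs a f)) (sym (distribˡ a _ _))

    ∑-++ : ∀ (xs ys : List A) f → ∑ (xs ++ ys) f ≈ ∑ xs f + ∑ ys f
    ∑-++ []       ys f = sym (+-identityˡ _)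
    ∑-++ (x ∷ xs) ys f = trans (+-congˡ (∑-++ xs ys f)) (sym (+-assoc _ _ _))

  ∑-comm : ∀ {A B : Set} (xs : List A) (ys : List B) (f : A → B → Carrier) →
           ∑ xs (λ x → ∑ ys (f x)) ≈ ∑ ys (λ y → ∑ xs (λ x → f x y))
  ∑-comm []       ys f = sym (∑-zero ys)
  ∑-comm (x ∷ xs) ys f = trans (+-congˡ (∑-comm xs ys f)) (sym (∑-+ ys _ _))

  ∑-map : ∀ {A B : Set} (h : A → B) xs f → ∑ (map h xs) f ≈ ∑ xs (f ∘ h)
  ∑-map h []       f = refl
  ∑-map h (x ∷ xs) f = +-congˡ (∑-map h xs f)

  ∑-cartesianProductWith : ∀ {A B C : Set} (h : A → B → C) xs ys f →
    ∑ (cartesianProductWith h xs ys) f ≈ ∑ xs (λ x → ∑ ys (λ y → f (h x y)))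
  ∑-cartesianProductWith h []       ys f = refl
  ∑-cartesianProductWith h (x ∷ xs) ys f = trans (∑-++ (map (h x) ys) _ f)
    (+-cong (∑-map (h x) ys f) (∑-cartesianProductWith h xs ys f))

  -- Iverson brackets

  ⟦_⟧ : ∀ {P : Set} → Dec P → Carrier
  ⟦ p ⟧ = if does p then 1# else 0#

  module _ {P : Set} where

    ⟦⟧-true : (p : Dec P) → P → ⟦ p ⟧ ≈ 1#
    ⟦⟧-true (yes _) _ = refl
    ⟦⟧-true (no ¬p) p = contradiction p ¬p

    ⟦⟧-false : (p : Dec P) → ¬ P → ⟦ p ⟧ ≈ 0#
    ⟦⟧-false (yes p) ¬p = contradiction p ¬p
    ⟦⟧-false (no _)  _  = refl

    -- Lets an identity that holds only under `P` be applied inside a sum over everything.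
    ⟦⟧-guard : (p : Dec P) → ∀ {x y} → (P → x ≈ y) → ⟦ p ⟧ * x ≈ ⟦ p ⟧ * y
    ⟦⟧-guard (yes p) x≈y = *-congˡ (x≈y p)
    ⟦⟧-guard (no _)  _   = trans (zeroˡ _) (sym (zeroˡ _))

  ⟦⟧-⇔ : ∀ {P Q : Set} (p : Dec P) (q : Dec Q) → (P → Q) → (Q → P) → ⟦ p ⟧ ≈ ⟦ q ⟧
  ⟦⟧-⇔ (yes p) q P→Q _   = sym (⟦⟧-true q (P→Q p))
  ⟦⟧-⇔ (no ¬p) q _   Q→P = sym (⟦⟧-false q (¬p ∘ Q→P))

  ⟦⟧-× : ∀ {P Q : Set} (p : Dec P) (q : Dec Q) → ⟦ p ×-dec q ⟧ ≈ ⟦ p ⟧ * ⟦ q ⟧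
  ⟦⟧-× (yes _) (yes _) = sym (*-identityˡ 1#)
  ⟦⟧-× (yes _) (no  _) = sym (*-identityˡ 0#)
  ⟦⟧-× (no _)  q       = sym (zeroˡ ⟦ q ⟧)

  ∑-filter : ∀ {A : Set} {P : A → Set} (P? : Decidable P) xs f →
             ∑ (filter P? xs) f ≈ ∑ xs (λ x → ⟦ P? x ⟧ * f x)
  ∑-filter P? []       f = refl
  ∑-filter P? (x ∷ xs) f with does (P? x)
  ... | true  = +-cong (sym (*-identityˡ _)) (∑-filter P? xs f)
  ... | false = trans (∑-filter P? xs f) (trans (sym (+-identityˡ _)) (+-congʳ (sym (zeroˡ _))))

  -- Sums over subsets

  ∑-subsets-suc : ∀ n (f : Subset (suc n) → Carrier) →
    ∑ (allVecs sides (suc n)) f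
      ≈ ∑ (allVecs sides n) (f ∘ (inside ∷_)) + ∑ (allVecs sides n) (f ∘ (outside ∷_))
  ∑-subsets-suc n f = trans (∑-cartesianProductWith _∷_ sides (allVecs sides n) f)
    (+-congˡ (+-identityʳ _))

  ∑-empty : ∀ n → ∑ (allVecs sides n) (λ S → ⟦ ¬? (nonempty? S) ⟧) ≈ 1#
  ∑-empty zero    = trans (+-identityʳ _) (⟦⟧-true (¬? (nonempty? [])) λ ())
  ∑-empty (suc n) = begin
    _ ≈⟨ ∑-subsets-suc n _ ⟩
    _ ≈⟨ +-cong
           (trans (∑-cong (allVecs sides n) λ S →
               ⟦⟧-false (¬? (nonempty? (inside ∷ S))) λ e → e (zero , here))
             (∑-zero (allVecs sides n)))
           (trans (∑-cong (allVecs sides n) λ S →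
               ⟦⟧-⇔ (¬? (nonempty? (outside ∷ S))) (¬? (nonempty? S))
               drop-∷-Empty λ { e (suc x , there x∈S) → e (x , x∈S) })
             (∑-empty n)) ⟩
    0# + 1# ≈⟨ +-identityˡ 1# ⟩
    1#      ∎

  -- Here `e` need not be the term `- 1#` itself: it is later `b * β`, whose powers occur in
  -- `boxWeight-split`.
  module _ {e} (e≈-1 : e ≈ - 1#) where

    ex+x≈0 : ∀ x → e * x + x ≈ 0#
    ex+x≈0 x = trans (+-congʳ (trans (*-congʳ e≈-1) (-1*x≈-x x))) (-‿inverseˡ x)

    -- With A as the set of admitted elements the sum factors as ∏ₓ (1 + e [x ∈ A]).
    ∑-signed-subsets : ∀ {n} {A : Fin n → Set} (A? : Decidable A) → ∃ A →
      ∑ (allVecs sides n) (λ S → ⟦ Lift? A? S ⟧ * e ^ ∣ S ∣) ≈ 0#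
    ∑-signed-subsets {suc n} {A} A? a = begin
      ∑ (allVecs sides (suc n)) (λ S → ⟦ Lift? A? S ⟧ * e ^ ∣ S ∣)
        ≈⟨ ∑-subsets-suc n _ ⟩
      _ ≈⟨ +-cong
             (trans (∑-cong (allVecs sides n) with-zero)
               (∑-*ˡ (allVecs sides n) (⟦ A? zero ⟧ * e) _))
             (∑-cong (allVecs sides n) λ S → *-congʳ (outside-⇔ S)) ⟩
      ⟦ A? zero ⟧ * e * X + X
        ≈⟨ cancel a ⟩
      0# ∎
      where
      X = ∑ (allVecs sides n) (λ S → ⟦ Lift? (A? ∘ suc) S ⟧ * e ^ ∣ S ∣)

      outside-⇔ : ∀ S → ⟦ Lift? A? (outside ∷ S) ⟧ ≈ ⟦ Lift? (A? ∘ suc) S ⟧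
      outside-⇔ S = ⟦⟧-⇔ (Lift? A? (outside ∷ S)) (Lift? (A? ∘ suc) S)
        (λ h x∈S → h (there x∈S)) (λ { h (there x∈S) → h x∈S })

      inside-⇔ : ∀ S → ⟦ Lift? A? (inside ∷ S) ⟧ ≈ ⟦ A? zero ⟧ * ⟦ Lift? (A? ∘ suc) S ⟧
      inside-⇔ S = trans
        (⟦⟧-⇔ (Lift? A? (inside ∷ S)) (A? zero ×-dec Lift? (A? ∘ suc) S)
          (λ h → h here , λ x∈S → h (there x∈S))
          (λ { (a₀ , _) here → a₀ ; (_ , h) (there x∈S) → h x∈S }))
        (⟦⟧-× (A? zero) (Lift? (A? ∘ suc) S))

      with-zero : ∀ S → ⟦ Lift? A? (inside ∷ S) ⟧ * (e * e ^ ∣ S ∣)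
                      ≈ ⟦ A? zero ⟧ * e * (⟦ Lift? (A? ∘ suc) S ⟧ * e ^ ∣ S ∣)
      with-zero S = trans (*-congʳ (inside-⇔ S))
        (solve 4 (λ a l e p → (a :* l) :* (e :* p) := (a :* e) :* (l :* p)) refl _ _ _ _)

      -- If the witness is `zero`, the factor of `zero` is 1 + e = 0; otherwise the witness lies in
      -- the tail and the remaining factors `X` vanish by induction.
      cancel : ∃ A → ⟦ A? zero ⟧ * e * X + X ≈ 0#
      cancel (zero , a₀)  = trans
        (+-congʳ (*-congʳ (trans (*-congʳ (⟦⟧-true (A? zero) a₀)) (*-identityˡ e)))) (ex+x≈0 X)
      cancel (suc x , aₓ) = trans (+-cong (*-congˡ X≈0) X≈0)
        (trans (+-identityʳ _) (zeroʳ _))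
        where X≈0 = ∑-signed-subsets (A? ∘ suc) (x , aₓ)

  -- Weights of boxes and tableaux

  module _ (b β : Carrier) (bβ≈-1 : b * β ≈ - 1#) where

    -- The truncated subtraction gives the empty set weight 1; it is removed by a nonemptiness
    -- condition wherever weights are summed.
    boxWeight : ∀ {n} → Subset n → Carrier
    boxWeight S = b ^ (∣ S ∣ ∸ 1) * β ^ ∣ S ∣

    tableauWeight : ∀ {n m} → Vec (Subset n) m → Carrier
    tableauWeight []      = 1#
    tableauWeight (S ∷ T) = boxWeight S * tableauWeight T

    -- For nonempty `S` with s elements, b^(s-1) β^s = β (bβ)^(s-1) = -β (bβ)^s because bβ = -1. The
    -- first bracket on the right cancels the signed term of the empty set.
    boxWeight-split : ∀ {n} {A : Fin n → Set} (A? : Decidable A) S →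
      ⟦ nonempty? S ×-dec Lift? A? S ⟧ * boxWeight S
        ≈ β * (⟦ ¬? (nonempty? S) ⟧ + - 1# * (⟦ Lift? A? S ⟧ * (b * β) ^ ∣ S ∣))
    boxWeight-split {n} A? S with nonempty? S
    ... | no ∅S rewrite Empty-unique ∅S | ∣⊥∣≡0 n = begin
      0# * (1# * 1#)           ≈⟨ zeroˡ _ ⟩
      0#                       ≈⟨ zeroʳ β ⟨
      β * 0#                   ≈⟨ *-congˡ (-‿inverseʳ 1#) ⟨
      β * (1# + - 1#)          ≈⟨ *-congˡ (+-congˡ (*-identityʳ _)) ⟨
      β * (1# + - 1# * 1#)
        ≈⟨ *-congˡ (+-congˡ (*-congˡ (trans (*-identityʳ _)
             (⟦⟧-true (Lift? A? ⊥) λ x∈⊥ → contradiction x∈⊥ ∉⊥)))) ⟨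
      β * (1# + - 1# * (⟦ Lift? A? ⊥ ⟧ * 1#)) ∎
    ... | yes ne with ∣ S ∣ | nonempty⇒∣p∣>0 ne
    ...   | suc m | _ = begin
      L * (b ^ m * (β * β ^ m))                    ≈⟨ *-identityˡ _ ⟨
      1# * (L * (b ^ m * (β * β ^ m)))             ≈⟨ *-congʳ 1≈-1*bβ ⟩
      - 1# * (b * β) * (L * (b ^ m * (β * β ^ m)))
        -- The `con 0` is the bracket for the empty set, which is `0#` at a nonempty `S`.
        ≈⟨ solve 6 (λ e f l p q β′ → (e :* f) :* (l :* (p :* (β′ :* q))) :=
             β′ :* (con 0 :+ e :* (l :* (f :* (p :* q))))) refl (- 1#) (b * β) L (b ^ m) (β ^ m) β ⟩
      β * (0# + - 1# * (L * (b * β * (b ^ m * β ^ m))))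
        ≈⟨ *-congˡ (+-congˡ (*-congˡ (*-congˡ (*-congˡ (^-distrib-* b β m))))) ⟨
      β * (0# + - 1# * (L * (b * β * (b * β) ^ m))) ∎
      where
      L = ⟦ Lift? A? S ⟧
      1≈-1*bβ : 1# ≈ - 1# * (b * β)
      1≈-1*bβ = begin
        1#               ≈⟨ -‿involutive 1# ⟨
        - - 1#           ≈⟨ -1*x≈-x (- 1#) ⟨
        - 1# * - 1#      ≈⟨ *-congˡ bβ≈-1 ⟨
        - 1# * (b * β)   ∎

    -- The signed sum over all subsets of the nonempty set `A` vanishes, which leaves only the
    -- correction for the empty set.
    ∑-boxWeight : ∀ {n} {A : Fin n → Set} (A? : Decidable A) → ∃ A →
      ∑ (allVecs sides n) (λ S → ⟦ nonempty? S ×-dec Lift? A? S ⟧ * boxWeight S) ≈ β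
    ∑-boxWeight {n} A? a = begin
      _ ≈⟨ ∑-cong subsets (boxWeight-split A?) ⟩
      _ ≈⟨ ∑-*ˡ subsets β _ ⟩
      _ ≈⟨ *-congˡ (trans (∑-+ subsets _ _) (+-cong (∑-empty n)
             (trans (∑-*ˡ subsets (- 1#) _) (*-congˡ (∑-signed-subsets bβ≈-1 A? a))))) ⟩
      β * (1# + - 1# * 0#) ≈⟨ *-congˡ (trans (+-congˡ (zeroʳ _)) (+-identityʳ 1#)) ⟩
      β * 1#               ≈⟨ *-identityʳ β ⟩
      β                    ∎
      where subsets = allVecs sides n

    ∏-occurrence : ∀ {n} (S : Subset n) →
      ∏ (λ k → if does (k ∈ˢ? S) then β else 1#) ≈ β ^ ∣ S ∣
    ∏-occurrence []            = refl
    ∏-occurrence (inside  ∷ S) = *-congˡ (∏-occurrence S)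
    ∏-occurrence (outside ∷ S) = trans (*-identityˡ _) (∏-occurrence S)

    -- Double counting of pairs of a box and an entry in it, one box at a time: the exponents add up
    -- to the total size.
    ∏-occurrences : ∀ {n m} (T : Vec (Subset n) m) →
      ∏ (λ k → β ^ Vec.count (k ∈ˢ?_) T) ≈ β ^ totalSize T
    ∏-occurrences {n} []      = sum-replicate-zero n
    ∏-occurrences     (S ∷ T) = begin
      ∏ (λ k → β ^ Vec.count (k ∈ˢ?_) (S ∷ T))
        ≈⟨ sum-cong-≋ head-factor ⟩
      ∏ (λ k → (if does (k ∈ˢ? S) then β else 1#) * β ^ Vec.count (k ∈ˢ?_) T)
        ≈⟨ ∑-distrib-+ (λ k → if does (k ∈ˢ? S) then β else 1#) _ ⟩
      _ ≈⟨ *-cong (∏-occurrence S) (∏-occurrences T) ⟩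
      β ^ ∣ S ∣ * β ^ totalSize T
        ≈⟨ ^-homo-* β ∣ S ∣ (totalSize T) ⟨
      β ^ (∣ S ∣ ℕ.+ totalSize T) ∎
      where
      head-factor : ∀ k → β ^ Vec.count (k ∈ˢ?_) (S ∷ T)
        ≈ (if does (k ∈ˢ? S) then β else 1#) * β ^ Vec.count (k ∈ˢ?_) T
      head-factor k with does (k ∈ˢ? S)
      ... | true  = refl
      ... | false = sym (*-identityˡ _)

    -- Nonemptiness bounds the number of boxes by the total size, so the truncated subtraction
    -- splits exactly into one exponent per box.
    tableauWeight-formula : ∀ {n m} (T : Vec (Subset n) m) → (∀ k → Nonempty (lookup T k)) →
      b ^ (totalSize T ∸ m) * β ^ totalSize T ≈ tableauWeight T
    tableauWeight-formula []      ne = *-identityˡ 1#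
    tableauWeight-formula {m = suc m} (S ∷ T) ne with ∣ S ∣ | nonempty⇒∣p∣>0 (ne zero)
    ... | suc p | _ = begin
      b ^ (p ℕ.+ s ∸ m) * β ^ (suc p ℕ.+ s)
        ≡⟨ ≡.cong (λ q → b ^ q * β ^ (suc p ℕ.+ s))
             (ℕ.+-∸-assoc p (nonempty⇒length≤totalSize T (ne ∘ suc))) ⟩
      b ^ (p ℕ.+ (s ∸ m)) * β ^ (suc p ℕ.+ s)
        ≈⟨ *-cong (^-homo-* b p (s ∸ m)) (^-homo-* β (suc p) s) ⟩
      (b ^ p * b ^ (s ∸ m)) * (β ^ suc p * β ^ s)
        ≈⟨ solve 4 (λ x y z w → (x :* y) :* (z :* w) := (x :* z) :* (y :* w)) refl _ _ _ _ ⟩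
      (b ^ p * β ^ suc p) * (b ^ (s ∸ m) * β ^ s)
        ≈⟨ *-congˡ (tableauWeight-formula T (ne ∘ suc)) ⟩
      b ^ p * β ^ suc p * tableauWeight T ∎
      where s = totalSize T

    -- Summing out the boxes

    module _ (θ : SkewShape) {n} (col : ∀ j → columnLength θ j ≤ n) where
      open Admissibility θ {n}

      private
        subsets = allVecs sides n
        fillings = λ (bs : List Box) → allVecs subsets (length bs)

      -- Stated for any list of boxes of `θ`, not only `boxes θ`, so that the induction can drop the
      -- first box.
      ∑-admissible : ∀ bs → All (_∈ᶿ θ) bs →
        ∑ (fillings bs) (λ T → ⟦ admissible? bs T ⟧ * tableauWeight T) ≈ β ^ length bs
      ∑-admissible []       []            = trans (+-identityʳ _) (*-identityˡ 1#)
      ∑-admissible (b′ ∷ bs) (b∈θ ∷ bs⊆θ) = begin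
        ∑ (fillings (b′ ∷ bs)) (λ T → ⟦ admissible? (b′ ∷ bs) T ⟧ * tableauWeight T)
          ≈⟨ ∑-cartesianProductWith _∷_ subsets (fillings bs) _ ⟩
        ∑ subsets (λ S → ∑ (fillings bs) (λ T →
          ⟦ head? S T ×-dec admissible? bs T ⟧ * (boxWeight S * tableauWeight T)))
          -- The sets allowed in the first box depend on `T`, so `T` has to be fixed before `S` is
          -- summed.
          ≈⟨ ∑-comm subsets (fillings bs) _ ⟩
        ∑ (fillings bs) (λ T → ∑ subsets (λ S →
          ⟦ head? S T ×-dec admissible? bs T ⟧ * (boxWeight S * tableauWeight T)))
          ≈⟨ ∑-cong (fillings bs) sum-head ⟩
        ∑ (fillings bs) (λ T → β * (⟦ admissible? bs T ⟧ * tableauWeight T))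
          ≈⟨ ∑-*ˡ (fillings bs) β _ ⟩
        β * ∑ (fillings bs) (λ T → ⟦ admissible? bs T ⟧ * tableauWeight T)
          ≈⟨ *-congˡ (∑-admissible bs bs⊆θ) ⟩
        β * β ^ length bs ∎
        where
        head? : ∀ S T → Dec (Nonempty S × Lift (Allowed b′ bs T) S)
        head? S T = nonempty? S ×-dec Lift? (allowed? b′ bs T) S

        sum-head : ∀ T →
          ∑ subsets (λ S → ⟦ head? S T ×-dec admissible? bs T ⟧ * (boxWeight S * tableauWeight T))
            ≈ β * (⟦ admissible? bs T ⟧ * tableauWeight T)
        sum-head T = begin
          _ ≈⟨ ∑-cong subsets (λ S → trans (*-congʳ (⟦⟧-× (head? S T) (admissible? bs T)))
                 (solve 4 (λ h a w v → (h :* a) :* (w :* v) := (a :* v) :* (h :* w)) refl _ _ _ _)) ⟩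
          _ ≈⟨ ∑-*ˡ subsets (⟦ admissible? bs T ⟧ * tableauWeight T) _ ⟩
          ⟦ admissible? bs T ⟧ * tableauWeight T * ∑ subsets (λ S → ⟦ head? S T ⟧ * boxWeight S)
            ≈⟨ *-assoc _ _ _ ⟩
          -- An allowed entry is only known to exist when `T` is admissible; for other `T` both
          -- sides are 0.
          _ ≈⟨ ⟦⟧-guard (admissible? bs T) (λ adm → *-congˡ
                 (∑-boxWeight (allowed? b′ bs T) (allowed-offset col b′ bs T b∈θ adm))) ⟩
          ⟦ admissible? bs T ⟧ * (tableauWeight T * β)
            ≈⟨ solve 3 (λ a v β′ → a :* (v :* β′) := β′ :* (a :* v)) refl _ _ _ ⟩
          β * (⟦ admissible? bs T ⟧ * tableauWeight T) ∎

      Grothendieck-specialised : Grothendieck R θ n (λ _ → β) b ≈ β ^ size θ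
      Grothendieck-specialised = begin
        Grothendieck R θ n (λ _ → β) b
          ≈⟨ ∑-filter (isSVT? θ) (allFillings θ n) _ ⟩
        _ ≈⟨ ∑-cong (allFillings θ n) term≈ ⟩
        ∑ (allFillings θ n) (λ T → ⟦ admissible? (boxes θ) T ⟧ * tableauWeight T)
          ≈⟨ ∑-admissible (boxes θ) (All.tabulate (∈-boxes⁻ θ)) ⟩
        β ^ size θ ∎
        where
        term≈ : ∀ T → ⟦ isSVT? θ T ⟧ *
            (b ^ (weight θ T ∸ size θ) * ∏ (λ k → β ^ ω θ T k))
          ≈ ⟦ admissible? (boxes θ) T ⟧ * tableauWeight T
        term≈ T = trans
          (*-cong (⟦⟧-⇔ (isSVT? θ T) (admissible? (boxes θ) T) svt⇒admissible admissible⇒svt)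
            (*-congˡ (∏-occurrences T)))
          (⟦⟧-guard (admissible? (boxes θ) T) λ adm →
            tableauWeight-formula T (admissible⇒nonempty (boxes θ) T adm))

-- Specialization to a field, with `b` the negated inverse of `β`

theoremB1 : ∀ {c ℓ₁ ℓ₂} (K : HeytingField c ℓ₁ ℓ₂) → let open Field K in
    ∀ (n : ℕ) .{{_ : NonZero n}} (θ : SkewShape) →
    (∀ j → columnLength θ j ≤ n) →
    ∀ (β : Carrier) (β#0 : β # 0#) →
    Grothendieck commutativeRing θ n (λ _ → β) (- inverse β β#0) ≈ β ^ size θ
theoremB1 K n θ col β β#0 =
  RingSums.Grothendieck-specialised commutativeRing (- inverse β β#0) β -β⁻¹β≈-1 θ col
  where
  open Field K
  open import Algebra.Properties.Ring (CommutativeRing.ring commutativeRing) using (-‿distribˡ-*)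
  -β⁻¹β≈-1 : - inverse β β#0 * β ≈ - 1#
  -β⁻¹β≈-1 = trans (sym (-‿distribˡ-* (inverse β β#0) β))
    (-‿cong (trans (*-comm (inverse β β#0) β) (*-inverseʳ β β#0)))
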